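{- Let $t$ be a positive integer and let $G$ be a finite graph. If $\mathrm{zig}(G)\ge t$, then $G$ contains the complete graph $K_{\lfloor t/2\rfloor+1}$ as an odd-minor.
   Context: All graphs are finite and simple. A proper coloring of $G$ is a map $c:V(G)\to\mathbb{N}$ with $c(u)\neq c(v)$ for every edge $uv$. Given a proper coloring $c$ of $G$, a zigzag of length $k$ in $(G,c)$ is a sequence of vertices $z_1,\dots,z_k\in V(G)$ with $c(z_1)<c(z_2)<\cdots<c(z_k)$ such that every vertex of $\{z_i: i \text{ odd}\}$ is adjacent to every vertex of $\{z_i: i\text{ even}\}$ (i.e. these two sets form the sides of a complete bipartite subgraph). The zig-zag number $\mathrm{zig}(G)$ is the minimum, over all proper colorings $c$ of $G$, of the maximum length of a zigzag in $(G,c)$. A graph $G$ contains $H$ as an odd-minor if a graph isomorphic to $H$ can be obtained from some subgraph $G'\subseteq G$ by choosing an edge-cut of $G'$ (the set of edges between $S$ and $V(G')\setminus S$ for some $S\subseteq V(G')$) and contracting all edges of this cut simultaneously. -}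

module Defs where

open import Data.Nat using (ℕ; _<_; _≤_; _%_)
open import Data.Fin using (Fin; toℕ)
open import Data.Bool using (Bool; true)
open import Data.Product using (Σ; _×_; ∃; ∃-syntax)
open import Relation.Nullary using (¬_)
open import Relation.Binary.PropositionalEquality using (_≡_; _≢_)
open import Relation.Binary.Construct.Closure.ReflexiveTransitive using (Star)

record Graph : Set₁ where
  field
    n      : ℕ
    E      : Fin n → Fin n → Set
    sym    : ∀ {u v} → E u v → E v u
    irrefl : ∀ {u} → ¬ E u u
open Graph public

Proper : (G : Graph) → (Fin (n G) → ℕ) → Set
Proper G c = ∀ u v → E G u v → c u ≢ c v

-- A zigzag of length k in (G,c): vertices z_1..z_k (indexed 0..k-1 here) with
-- strictly increasing colors, and every vertex at an odd position (1-based,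
-- i.e. even 0-based index) adjacent to every vertex at an even position.
record Zigzag (G : Graph) (c : Fin (n G) → ℕ) (k : ℕ) : Set where
  field
    z        : Fin k → Fin (n G)
    increasing : ∀ (i j : Fin k) → toℕ i < toℕ j → c (z i) < c (z j)
    complete : ∀ (i j : Fin k) → toℕ i % 2 ≡ 0 → toℕ j % 2 ≡ 1 → E G (z i) (z j)

-- zig(G) ≥ t, unfolded: zig(G) is the minimum over proper colorings c of the
-- maximum length of a zigzag in (G,c); this minimum is ≥ t iff for every proper
-- coloring the maximum zigzag length is ≥ t, i.e. some zigzag has length ≥ t.
ZigAtLeast : Graph → ℕ → Set
ZigAtLeast G t = ∀ (c : Fin (n G) → ℕ) → Proper G c →
  ∃[ k ] (t ≤ k × Zigzag G c k)

-- G contains K_m as an odd-minor: there is a subgraph G' = (V', E') of G and a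
-- set S ⊆ V' such that contracting the cut edges of G' between S and V' ∖ S
-- yields K_m. The vertices of the contraction are the connected components of
-- (V', cut edges); we record them through a map φ : V' → Fin m which is
-- surjective onto Fin m and identifies exactly the vertices joined by a path of
-- cut edges (so φ is a bijection components ≅ Fin m), and the contracted graph
-- is complete: any two distinct classes are joined by an edge of G'.
record OddMinor (G : Graph) (m : ℕ) : Set where
  field
    V'      : Fin (n G) → Bool
    E'      : Fin (n G) → Fin (n G) → Bool
    E'⊆E    : ∀ u v → E' u v ≡ true → E G u v
    E'-ends : ∀ u v → E' u v ≡ true → V' u ≡ true × V' v ≡ true
    E'-sym  : ∀ u v → E' u v ≡ true → E' v u ≡ true
    S       : Fin (n G) → Bool
    φ       : Fin (n G) → Fin m
  Cut : Fin (n G) → Fin (n G) → Set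
  Cut u v = E' u v ≡ true × S u ≢ S v
  field
    φ-onto     : ∀ (a : Fin m) → ∃[ u ] (V' u ≡ true × φ u ≡ a)
    φ-sound    : ∀ u v → V' u ≡ true → V' v ≡ true → φ u ≡ φ v → Star Cut u v
    φ-complete : ∀ u v → V' u ≡ true → V' v ≡ true → Star Cut u v → φ u ≡ φ v
    clique     : ∀ (a b : Fin m) → a ≢ b →
                 ∃[ u ] ∃[ v ] (V' u ≡ true × V' v ≡ true × φ u ≡ a × φ v ≡ b × E' u v ≡ true)

{-# OPTIONS --safe #-}
module Submission where

-- Peel off successive maximal connected induced bipartite subgraphs ("layers")
-- and colour a vertex by (layer, side). By maximality a vertex adjacent to an
-- earlier layer has neighbours on both sides of it, so adjacent layers are
-- joined by edges of either parity. A zigzag x₁ y₁ x₂ y₂ … meets a layer at most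
-- twice, in some xᵢ and some yⱼ, so the x's can be matched with the y's in such
-- a way that the layers of distinct pairs are distinct. The unions of the layers
-- of the pairs are then branch sets, and splitting the topmost pair gives one
-- more.
--
-- Adjacency is not assumed decidable, so the layers are taken in a decidable
-- subgraph: the edges of the zigzags provided for finitely many injective
-- colourings. Injective colourings suffice, because a zigzag of an injective
-- refinement of a proper colouring is a zigzag of that colouring.

open import Defs
open import Data.Nat using (ℕ; zero; suc; z≤n; s≤s; s≤s⁻¹; _≤_; _<_; _/_; _%_; _+_; _*_; _^_)
import Data.Nat as ℕ
import Data.Nat.Properties as ℕ
open import Data.Nat.DivMod using (m*n%n≡0; [m+kn]%n≡m%n; m/n*n≤m)
open import Data.Nat.Induction using (<-wellFounded)
open import Data.Fin using (Fin; zero; suc; toℕ; fromℕ; fromℕ<; _≟_; combine; finToFun; funToFin; punchIn)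
open import Data.Fin.Properties using (any?; toℕ<n; toℕ-injective; toℕ-fromℕ; toℕ-fromℕ<; combine-monoˡ-<; combine-injectiveˡ; combine-injectiveʳ; finToFun-funToFin; punchIn-punchOut; punchInᵢ≢i; punchIn-injective)
open import Data.Fin.Permutation using (_⟨$⟩ʳ_; insert) renaming (Permutation′ to Permutation; id to idᵖ)
open import Data.Fin.Subset using (Subset; _∈_; _-_; ∣_∣)
open import Data.Fin.Subset.Properties using (x∈p∧x≢y⇒x∈p-y; x∈p⇒∣p-x∣<∣p∣; ∈⊤; ∣⊤∣≡n)
open import Data.Empty using (⊥)
open import Data.Bool using (Bool; true; false; not; if_then_else_; _xor_)
open import Data.Bool.Properties using (¬-not; not-¬) renaming (_≟_ to _≟ᵇ_)
open import Data.Product using (∃; ∃₂; _×_; _,_; proj₁; proj₂)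
open import Data.Sum using (_⊎_; inj₁; inj₂)
open import Function using (_∘_)
open import Function.Bundles using (module Injection)
open import Function.Properties.Inverse using (↔⇒↣)
open import Induction.WellFounded using (Acc; acc)
open import Level using (0ℓ)
open import Relation.Nullary using (¬_; Dec; yes; no; does; contradiction)
open import Relation.Nullary.Decidable using (dec-true; decidable-stable; ¬?; _×-dec_; _⊎-dec_; _→-dec_)
open import Relation.Binary using (Rel; Decidable; Symmetric)
open import Relation.Binary.Definitions using (tri<; tri≈; tri>)
open import Relation.Binary.PropositionalEquality as ≡ using (_≡_; _≢_; refl; cong; cong₂; subst; subst₂; ≢-sym)
open import Relation.Binary.Construct.Closure.ReflexiveTransitive as Star using (Star; ε; _◅_; _◅◅_)

private variable
  k m s : ℕ

-- Odd-minors from branch sets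

does⇒ : ∀ {P : Set} (P? : Dec P) → does P? ≡ true → P
does⇒ (yes p) _ = p

if-yes : ∀ {A P : Set} (P? : Dec P) → P → {x y : A} → (if does P? then x else y) ≡ x
if-yes (yes _) _ = refl
if-yes (no ¬p) p = contradiction p ¬p

if-no : ∀ {A P : Set} (P? : Dec P) → ¬ P → {x y : A} → (if does P? then x else y) ≡ y
if-no (yes p) ¬p = contradiction p ¬p
if-no (no _)  _  = refl

module _ {G : Graph} {F : Rel (Fin (n G)) 0ℓ} (F? : Decidable F)
         (F⊆E : ∀ {u v} → F u v → E G u v) (F-sym : Symmetric F)
         (S : Fin (n G) → Bool) (B : Fin (suc m) → Fin (n G) → Set) where

  BranchEdge : Fin (suc m) → Rel (Fin (n G)) 0ℓ
  BranchEdge a u v = B a u × B a v × F u v × S u ≢ S v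

  -- The subgraph keeps an edge only if its ends lie in one branch set or on the same side of `S`.
  -- Cut edges thus never leave a branch set, while `BranchEdge` paths connect each to its root, so
  -- contracting the cut yields exactly the branch sets; the edges from `touching` survive it.
  branchSets⇒oddMinor :
    (∀ a v → Dec (B a v)) →
    (∀ {a b v} → B a v → B b v → a ≡ b) →
    (root : ∀ a → ∃ (B a)) →
    (∀ a {v} → B a v → Star (BranchEdge a) v (proj₁ (root a))) →
    (∀ a b → a ≢ b → ∃₂ λ u v → B a u × B b v × F u v × S u ≡ S v) →
    OddMinor G (suc m)
  branchSets⇒oddMinor B? disjoint root connected touching = record
    { V'         = λ v → does (covered? v)
    ; E'         = λ u v → does (kept? u v)
    ; E'⊆E       = λ u v e → F⊆E (proj₁ (does⇒ (kept? u v) e))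
    ; E'-ends    = λ u v e → let (_ , cu , cv , _) = does⇒ (kept? u v) e in
                     dec-true (covered? u) cu , dec-true (covered? v) cv
    ; E'-sym     = λ u v e → let (f , cu , cv , q) = does⇒ (kept? u v) e in
                     dec-true (kept? v u) (F-sym f , cv , cu , swap q)
    ; S          = S
    ; φ          = φ
    ; φ-onto     = λ a → let (v , b) = root a in v , dec-true (covered? v) (a , b) , φ-unique b
    ; φ-sound    = λ u v cu cv φu≡φv →
                     let bu = φ-member cu
                         bv = subst (λ a → B a v) (≡.sym φu≡φv) (φ-member cv)
                     in Star.map cut (connected _ bu ◅◅ Star.reverse flipEdge (connected _ bv))
    ; φ-complete = λ u v _ _ → Star.fold (λ u v → φ u ≡ φ v) (λ e → ≡.trans (cut-φ e)) refl
    ; clique     = clique′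
    }
    where
    Covered : Fin (n G) → Set
    Covered v = ∃ λ a → B a v

    covered? : ∀ v → Dec (Covered v)
    covered? v = any? (λ a → B? a v)

    φ : Fin (n G) → Fin (suc m)
    φ v with covered? v
    ... | yes (a , _) = a
    ... | no _        = zero

    φ-unique : ∀ {a v} → B a v → φ v ≡ a
    φ-unique {a} {v} b with covered? v
    ... | yes (_ , b′) = disjoint b′ b
    ... | no ¬c        = contradiction (a , b) ¬c

    φ-member : ∀ {v} → does (covered? v) ≡ true → B (φ v) v
    φ-member {v} c with covered? v | does⇒ (covered? v) c
    ... | yes (_ , b) | _ = b
    ... | no ¬c       | q = contradiction q ¬c

    Kept : Rel (Fin (n G)) 0ℓ
    Kept u v = F u v × Covered u × Covered v × (φ u ≡ φ v ⊎ S u ≡ S v)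

    kept? : Decidable Kept
    kept? u v = F? u v ×-dec covered? u ×-dec covered? v ×-dec (φ u ≟ φ v ⊎-dec S u ≟ᵇ S v)

    swap : ∀ {u v} → φ u ≡ φ v ⊎ S u ≡ S v → φ v ≡ φ u ⊎ S v ≡ S u
    swap (inj₁ e) = inj₁ (≡.sym e)
    swap (inj₂ e) = inj₂ (≡.sym e)

    flipEdge : ∀ {a u v} → BranchEdge a u v → BranchEdge a v u
    flipEdge (bu , bv , f , q) = bv , bu , F-sym f , ≢-sym q

    cut : ∀ {a u v} → BranchEdge a u v → does (kept? u v) ≡ true × S u ≢ S v
    cut (bu , bv , f , q) =
      dec-true (kept? _ _) (f , (_ , bu) , (_ , bv) , inj₁ (≡.trans (φ-unique bu) (≡.sym (φ-unique bv)))) , q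

    cut-φ : ∀ {u v} → does (kept? u v) ≡ true × S u ≢ S v → φ u ≡ φ v
    cut-φ {u} {v} (e , q) with does⇒ (kept? u v) e
    ... | _ , _ , _ , inj₁ φu≡φv = φu≡φv
    ... | _ , _ , _ , inj₂ Su≡Sv = contradiction Su≡Sv q

    clique′ : ∀ a b → a ≢ b → ∃ λ u → ∃ λ v → does (covered? u) ≡ true × does (covered? v) ≡ true ×
              φ u ≡ a × φ v ≡ b × does (kept? u v) ≡ true
    clique′ a b a≢b with touching a b a≢b
    ... | u , v , bu , bv , f , q =
      u , v , dec-true (covered? u) (a , bu) , dec-true (covered? v) (b , bv) , φ-unique bu , φ-unique bv ,
      dec-true (kept? u v) (f , (a , bu) , (b , bv) , inj₂ q)

-- Greedy layering into connected bipartite subgraphs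

LayerEdge : Rel (Fin k) 0ℓ → (Fin k → ℕ) → (Fin k → Bool) → ℕ → Rel (Fin k) 0ℓ
LayerEdge F layer side l u v = layer u ≡ l × layer v ≡ l × F u v × side u ≢ side v

-- `layer<` turns layer and side into a colour from the fixed palette `Fin (k * 2)`. `saturated` is
-- what survives of maximality: a vertex missing one side of an earlier layer could have been added
-- to that side.
record Layering (F : Rel (Fin k) 0ℓ) : Set where
  field
    layer     : Fin k → ℕ
    side      : Fin k → Bool
    layer<    : ∀ v → layer v < k
    bipartite : ∀ {u v} → layer u ≡ layer v → F u v → side u ≢ side v
    connected : ∀ {u v} → layer u ≡ layer v → Star (LayerEdge F layer side (layer u)) u v
    saturated : ∀ {u v} → layer u < layer v → F v u → ∀ b →
                ∃ λ w → layer w ≡ layer u × side w ≡ b × F v w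

module GreedyLayering {F : Rel (Fin k) 0ℓ} (F? : Decidable F) (F-sym : Symmetric F)
                      (F-irrefl : ∀ {u} → ¬ F u u) where

  -- Layers below c are in use, the last of them still growing; the vertices
  -- not yet placed all carry the layer c and lie in U.
  record Partial (c : ℕ) (U : Subset k) : Set where
    field
      layer     : Fin k → ℕ
      side      : Fin k → Bool
      layer≤    : ∀ v → layer v ≤ c
      unplaced  : ∀ {v} → layer v ≡ c → v ∈ U
      size      : c + ∣ U ∣ ≤ k
      bipartite : ∀ {u v} → layer u < c → layer u ≡ layer v → F u v → side u ≢ side v
      connected : ∀ {u v} → layer u < c → layer u ≡ layer v →
                  Star (LayerEdge F layer side (layer u)) u v
      saturated : ∀ {u v} → suc (layer u) < c → layer u < layer v → F v u → ∀ b →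
                  ∃ λ w → layer w ≡ layer u × side w ≡ b × F v w

    Sees : Fin k → ℕ → Bool → Set
    Sees v l b = ∃ λ w → layer w ≡ l × side w ≡ b × F v w

    sees? : ∀ v l b → Dec (Sees v l b)
    sees? v l b = any? λ w → layer w ℕ.≟ l ×-dec side w ≟ᵇ b ×-dec F? v w

  module Extend {c : ℕ} {U : Subset k} (P : Partial c U) where
    open Partial P

    -- As `v` sees the open layer only on the side of `u`, putting it on the other side keeps the
    -- layer bipartite, and the edge to `u` keeps it connected.
    module Grow {u v} (last : suc (layer u) ≡ c) (new : layer v ≡ c) (vu : F v u)
                (one-sided : ¬ Sees v (layer u) (not (side u))) where

      u<c : layer u < c
      u<c = ℕ.≤-reflexive last

      layer⁺ : Fin k → ℕ
      layer⁺ w = if does (w ≟ v) then layer u else layer w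

      side⁺ : Fin k → Bool
      side⁺ w = if does (w ≟ v) then not (side u) else side w

      neighbours-side : ∀ {w} → layer w ≡ layer u → F v w → side w ≡ side u
      neighbours-side {w} e f with side w ≟ᵇ side u
      ... | yes q = q
      ... | no q  = contradiction (w , e , ¬-not q , f) one-sided

      edge⁺ : ∀ {l a b} → l < c → LayerEdge F layer side l a b → LayerEdge F layer⁺ side⁺ l a b
      edge⁺ {l} {a} {b} l<c (p , q , f , r) with a ≟ v | b ≟ v
      ... | yes refl | _        = contradiction (≡.trans (≡.sym p) new) (ℕ.<⇒≢ l<c)
      ... | no _     | yes refl = contradiction (≡.trans (≡.sym q) new) (ℕ.<⇒≢ l<c)
      ... | no _     | no _     = p , q , f , r

      path⁺ : ∀ {a b} → layer a < c → layer a ≡ layer b → Star (LayerEdge F layer⁺ side⁺ (layer a)) a b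
      path⁺ a<c e = Star.map (edge⁺ a<c) (connected a<c e)

      vu⁺ : LayerEdge F layer⁺ side⁺ (layer u) v u
      vu⁺ with v ≟ v | u ≟ v
      ... | no q  | _        = contradiction refl q
      ... | yes _ | yes refl = contradiction vu F-irrefl
      ... | yes _ | no _     = refl , refl , vu , λ e → not-¬ {side u} refl (≡.sym e)

      uv⁺ : LayerEdge F layer⁺ side⁺ (layer u) u v
      uv⁺ = let (p , q , f , r) = vu⁺ in q , p , F-sym f , ≢-sym r

      partial : Partial c (U - v)
      partial = record
        { layer     = layer⁺
        ; side      = side⁺
        ; layer≤    = layer≤⁺
        ; unplaced  = unplaced⁺
        ; size      = ℕ.≤-trans (ℕ.+-monoʳ-≤ c (ℕ.<⇒≤ (x∈p⇒∣p-x∣<∣p∣ (unplaced new)))) size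
        ; bipartite = bipartite⁺
        ; connected = connected⁺
        ; saturated = saturated⁺
        }
        where
        layer≤⁺ : ∀ w → layer⁺ w ≤ c
        layer≤⁺ w with w ≟ v
        ... | yes _ = ℕ.<⇒≤ u<c
        ... | no _  = layer≤ w

        unplaced⁺ : ∀ {w} → layer⁺ w ≡ c → w ∈ U - v
        unplaced⁺ {w} e with w ≟ v
        ... | yes _ = contradiction e (ℕ.<⇒≢ u<c)
        ... | no q  = x∈p∧x≢y⇒x∈p-y (unplaced e) q

        bipartite⁺ : ∀ {a b} → layer⁺ a < c → layer⁺ a ≡ layer⁺ b → F a b → side⁺ a ≢ side⁺ b
        bipartite⁺ {a} {b} a<c e f r with a ≟ v | b ≟ v
        ... | yes refl | yes refl = F-irrefl f
        ... | yes refl | no _     = not-¬ (neighbours-side (≡.sym e) f) (≡.sym r)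
        ... | no _     | yes refl = not-¬ (neighbours-side e (F-sym f)) r
        ... | no _     | no _     = bipartite a<c e f r

        connected⁺ : ∀ {a b} → layer⁺ a < c → layer⁺ a ≡ layer⁺ b →
                     Star (LayerEdge F layer⁺ side⁺ (layer⁺ a)) a b
        connected⁺ {a} {b} a<c e with a ≟ v | b ≟ v
        ... | yes refl | yes refl = ε
        ... | yes refl | no _     = vu⁺ ◅ path⁺ u<c e
        ... | no _     | no _     = path⁺ a<c e
        ... | no _     | yes refl =
          path⁺ a<c e ◅◅ subst (λ l → LayerEdge F layer⁺ side⁺ l u v) (≡.sym e) uv⁺ ◅ ε

        layer⁺-mono : ∀ {l w} → l < layer⁺ w → l < layer w
        layer⁺-mono {w = w} l<w with w ≟ v
        ... | yes refl = ℕ.<-≤-trans (ℕ.<-trans l<w u<c) (ℕ.≤-reflexive (≡.sym new))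
        ... | no _     = l<w

        sees⁺ : ∀ {b l d} → l < c → Sees b l d → ∃ λ w → layer⁺ w ≡ l × side⁺ w ≡ d × F b w
        sees⁺ l<c (w , p , q , f) = w , ≡.trans (if-no (w ≟ v) old) p , ≡.trans (if-no (w ≟ v) old) q , f
          where
          old : w ≢ v
          old refl = contradiction (≡.trans (≡.sym p) new) (ℕ.<⇒≢ l<c)

        saturated⁺ : ∀ {a b} → suc (layer⁺ a) < c → layer⁺ a < layer⁺ b → F b a → ∀ d →
                     ∃ λ w → layer⁺ w ≡ layer⁺ a × side⁺ w ≡ d × F b w
        saturated⁺ {a} {b} a<c a<b f d with a ≟ v
        ... | yes refl = contradiction last (ℕ.<⇒≢ a<c)
        ... | no _     = sees⁺ (ℕ.<-trans (ℕ.n<1+n _) a<c) (saturated a<c (layer⁺-mono a<b) f d)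

    -- The last layer is closed and `r` alone starts layer `c`. The other unplaced vertices move on
    -- to the mark `suc c`, the number of the layer that comes next.
    module Open (maximal : ∀ {u v} → suc (layer u) ≡ c → layer v ≡ c → F v u → Sees v (layer u) (not (side u)))
                {r} (new : layer r ≡ c) where

      layer⁺ : Fin k → ℕ
      layer⁺ w = if does (w ≟ r) then c else if does (layer w ℕ.≟ c) then suc c else layer w

      data View (w : Fin k) (l : ℕ) : Set where
        root    : w ≡ r → l ≡ c → View w l
        pending : w ≢ r → layer w ≡ c → l ≡ suc c → View w l
        placed  : layer w < c → l ≡ layer w → View w l

      view : ∀ w → View w (layer⁺ w)
      view w with w ≟ r | layer w ℕ.≟ c
      ... | yes e | _     = root e refl
      ... | no q  | yes e = pending q e (if-yes (layer w ℕ.≟ c) e)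
      ... | no _  | no q  = placed (ℕ.≤∧≢⇒< (layer≤ w) q) (if-no (layer w ℕ.≟ c) q)

      layer⁺-placed : ∀ {w} → layer w < c → layer⁺ w ≡ layer w
      layer⁺-placed {w} w<c with view w
      ... | root refl _   = contradiction new (ℕ.<⇒≢ w<c)
      ... | pending _ e _ = contradiction e (ℕ.<⇒≢ w<c)
      ... | placed _ e    = e

      layer⁺<c : ∀ {w} → layer⁺ w < c → layer w < c
      layer⁺<c {w} w<c with view w
      ... | root _ e      = contradiction e (ℕ.<⇒≢ w<c)
      ... | pending _ _ e = contradiction e (ℕ.<⇒≢ (ℕ.<-trans w<c (ℕ.n<1+n c)))
      ... | placed q _    = q

      layer⁺≡c : ∀ {w} → layer⁺ w ≡ c → w ≡ r
      layer⁺≡c {w} w≡c with view w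
      ... | root e _      = e
      ... | pending _ _ e = contradiction (≡.trans (≡.sym e) w≡c) ℕ.1+n≢n
      ... | placed q e    = contradiction (≡.trans (≡.sym e) w≡c) (ℕ.<⇒≢ q)

      same-layer : ∀ {a b} → layer⁺ a < c → layer⁺ a ≡ layer⁺ b → layer a < c × layer a ≡ layer b
      same-layer a<c e = layer⁺<c a<c , (
        ≡.trans (≡.sym (layer⁺-placed (layer⁺<c a<c)))
                (≡.trans e (layer⁺-placed (layer⁺<c (subst (_< c) e a<c)))))

      -- Only the layer just closed is new. There `u` itself serves for its own side and `maximal`
      -- for the other, which applies because `v`, lying above the last layer, must be unplaced.
      saturated′ : ∀ {u v} → layer u < c → layer u < layer v → F v u → ∀ b → Sees v (layer u) b
      saturated′ {u} {v} u<c u<v f b with suc (layer u) ℕ.≟ c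
      ... | no q  = saturated (ℕ.≤∧≢⇒< u<c q) u<v f b
      ... | yes e with b ≟ᵇ side u
      ...   | yes refl = u , refl , refl , f
      ...   | no q     = subst (Sees v (layer u)) (≡.sym (¬-not q))
                           (maximal e (ℕ.≤-antisym (layer≤ v) (subst (_≤ layer v) e u<v)) f)

      partial : Partial (suc c) (U - r)
      partial = record
        { layer     = layer⁺
        ; side      = side
        ; layer≤    = layer≤⁺
        ; unplaced  = unplaced⁺
        ; size      = ℕ.≤-trans (ℕ.≤-reflexive (≡.sym (ℕ.+-suc c _)))
                        (ℕ.≤-trans (ℕ.+-monoʳ-≤ c (x∈p⇒∣p-x∣<∣p∣ (unplaced new))) size)
        ; bipartite = bipartite⁺
        ; connected = connected⁺
        ; saturated = saturated⁺
        }
        where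
        layer≤⁺ : ∀ w → layer⁺ w ≤ suc c
        layer≤⁺ w with view w
        ... | root _ e      = ℕ.≤-trans (ℕ.≤-reflexive e) (ℕ.n≤1+n c)
        ... | pending _ _ e = ℕ.≤-reflexive e
        ... | placed q e    = ℕ.≤-trans (ℕ.≤-reflexive e) (ℕ.<⇒≤ (ℕ.m<n⇒m<1+n q))

        unplaced⁺ : ∀ {w} → layer⁺ w ≡ suc c → w ∈ U - r
        unplaced⁺ {w} w≡ with view w
        ... | root _ e      = contradiction (≡.trans (≡.sym w≡) e) ℕ.1+n≢n
        ... | pending q e _ = x∈p∧x≢y⇒x∈p-y (unplaced e) q
        ... | placed q e    = contradiction (≡.trans (≡.sym e) w≡) (ℕ.<⇒≢ (ℕ.m<n⇒m<1+n q))

        bipartite⁺ : ∀ {a b} → layer⁺ a < suc c → layer⁺ a ≡ layer⁺ b → F a b → side a ≢ side b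
        bipartite⁺ {a} {b} a≤c e f with layer⁺ a ℕ.≟ c
        ... | yes p with layer⁺≡c {a} p | layer⁺≡c {b} (≡.trans (≡.sym e) p)
        ...   | refl | refl = contradiction f F-irrefl
        bipartite⁺ {a} {b} a≤c e f | no q =
          let (p , e′) = same-layer (ℕ.≤∧≢⇒< (s≤s⁻¹ a≤c) q) e in bipartite p e′ f

        edge⁺ : ∀ {l a b} → l < c → LayerEdge F layer side l a b → LayerEdge F layer⁺ side l a b
        edge⁺ l<c (refl , q , f , s) =
          layer⁺-placed l<c , ≡.trans (layer⁺-placed (subst (_< c) (≡.sym q) l<c)) q , f , s

        connected⁺ : ∀ {a b} → layer⁺ a < suc c → layer⁺ a ≡ layer⁺ b →
                     Star (LayerEdge F layer⁺ side (layer⁺ a)) a b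
        connected⁺ {a} {b} a≤c e with layer⁺ a ℕ.≟ c
        ... | yes p with layer⁺≡c {a} p | layer⁺≡c {b} (≡.trans (≡.sym e) p)
        ...   | refl | refl = ε
        connected⁺ {a} {b} a≤c e | no q =
          let (p , e′) = same-layer (ℕ.≤∧≢⇒< (s≤s⁻¹ a≤c) q) e in
          subst (λ l → Star (LayerEdge F layer⁺ side l) a b) (≡.sym (layer⁺-placed p))
            (Star.map (edge⁺ p) (connected p e′))

        saturated⁺ : ∀ {a b} → suc (layer⁺ a) < suc c → layer⁺ a < layer⁺ b → F b a → ∀ d →
                     ∃ λ w → layer⁺ w ≡ layer⁺ a × side w ≡ d × F b w
        saturated⁺ {a} {b} a<c a<b f d =
          let (w , p , q , g) = saturated′ la<c la<lb f d in
          w , ≡.trans (layer⁺-placed (subst (_< c) (≡.sym p) la<c)) (≡.trans p (≡.sym la≡)) , q , g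
          where
          la<c : layer a < c
          la<c = layer⁺<c (s≤s⁻¹ a<c)

          la≡ : layer⁺ a ≡ layer a
          la≡ = layer⁺-placed la<c

          la<lb : layer a < layer b
          la<lb with view b
          ... | root refl _   = subst (layer a <_) (≡.sym new) la<c
          ... | pending _ e _ = subst (layer a <_) (≡.sym e) la<c
          ... | placed _ e    = subst₂ _<_ la≡ e a<b

  -- Growing and opening each remove a vertex from `U`, hence termination. Growing is tried first,
  -- so a layer is opened only when the previous one is maximal.
  complete : ∀ {c U} → Acc _<_ ∣ U ∣ → Partial c U → Layering F
  complete {c} {U} (acc smaller) P = search
    where
    open Partial P
    open Extend P

    search : Layering F
    search with any? (λ u → any? λ v → suc (layer u) ℕ.≟ c ×-dec layer v ℕ.≟ c ×-dec F? v u ×-dec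
                                       ¬? (sees? v (layer u) (not (side u))))
    ... | yes (u , v , p , q , f , ¬s) = complete (smaller (x∈p⇒∣p-x∣<∣p∣ (unplaced q))) (Grow.partial p q f ¬s)
    ... | no stuck with any? (λ r → layer r ℕ.≟ c)
    ...   | yes (r , e) = complete (smaller (x∈p⇒∣p-x∣<∣p∣ (unplaced e))) (Open.partial maximal e)
      where
      maximal : ∀ {u v} → suc (layer u) ≡ c → layer v ≡ c → F v u → Sees v (layer u) (not (side u))
      maximal p q f = decidable-stable (sees? _ _ _) (λ ¬s → stuck (_ , _ , p , q , f , ¬s))
    ...   | no full = record
      { layer     = layer
      ; side      = side
      -- Every opened layer has taken a vertex out of `U`, so `size` bounds their number `c` by `k`.
      ; layer<    = λ v → ℕ.<-≤-trans (layer<c v) (ℕ.≤-trans (ℕ.m≤m+n c _) size)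
      ; bipartite = bipartite (layer<c _)
      ; connected = connected (layer<c _)
      -- As `v` is placed in a still later layer, that of `u` is not the last one and so has been
      -- closed.
      ; saturated = λ u<v → saturated (ℕ.≤-trans (s≤s u<v) (layer<c _)) u<v
      }
      where
      layer<c : ∀ v → layer v < c
      layer<c v = ℕ.≤∧≢⇒< (layer≤ v) (λ e → full (v , e))

  layering : Layering F
  layering = complete (<-wellFounded _) (record
    { layer     = λ _ → 0
    ; side      = λ _ → false
    ; layer≤    = λ _ → z≤n
    ; unplaced  = λ _ → ∈⊤
    ; size      = ℕ.≤-reflexive (∣⊤∣≡n k)
    ; bipartite = λ ()
    ; connected = λ ()
    ; saturated = λ ()
    })

-- Matching of layers and the branch sets they form

align : (f g : Fin s → ℕ) → (∀ {i j} → f i ≡ f j → i ≡ j) → (∀ {i j} → g i ≡ g j → i ≡ j) →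
        ∃ λ (π : Permutation s) → ∀ {i j} → f (π ⟨$⟩ʳ i) ≡ g j → i ≡ j
align {zero}  f g _ _ = idᵖ , λ { {()} }
align {suc s} f g f-inj g-inj with any? (λ i → any? λ j → f i ℕ.≟ g j)
... | no ¬e = idᵖ , λ e → contradiction (_ , _ , e) ¬e
-- By injectivity the common value occurs only at `i` and `j`; matching these two and deleting them
-- leaves the same problem for `s`.
... | yes (i , j , fi≡gj) = insert j i π , λ {a} {b} → aligned a b
  where
  rest = align (f ∘ punchIn i) (g ∘ punchIn j)
               (punchIn-injective i _ _ ∘ f-inj) (punchIn-injective j _ _ ∘ g-inj)
  π = proj₁ rest

  aligned : ∀ a b → f (insert j i π ⟨$⟩ʳ a) ≡ g b → a ≡ b
  aligned a b e with j ≟ a | j ≟ b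
  ... | yes refl | _        = g-inj (≡.trans (≡.sym fi≡gj) e)
  ... | no _     | yes refl = contradiction (f-inj (≡.trans e (≡.sym fi≡gj))) (punchInᵢ≢i i _)
  ... | no j≢a   | no j≢b   = ≡.trans (≡.sym (punchIn-punchOut j≢a))
    (≡.trans (cong (punchIn j) (proj₂ rest (≡.trans e (cong g (≡.sym (punchIn-punchOut j≢b)))))) (punchIn-punchOut j≢b))

xor-involutive : ∀ a b → b ≡ a xor (a xor b)
xor-involutive false _     = refl
xor-involutive true  false = refl
xor-involutive true  true  = refl

-- `x a` and `y a` may share a layer; `x-inj`, `y-inj` and `aligned` together keep vertices of
-- different pairs in different layers.
record LayerPairs {F : Rel (Fin k) 0ℓ} (L : Layering F) (s : ℕ) : Set where
  open Layering L
  field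
    x y     : Fin s → Fin k
    xy      : ∀ a b → F (x a) (y b)
    x-inj   : ∀ {a b} → layer (x a) ≡ layer (x b) → a ≡ b
    y-inj   : ∀ {a b} → layer (y a) ≡ layer (y b) → a ≡ b
    aligned : ∀ {a b} → layer (x a) ≡ layer (y b) → a ≡ b
    p       : Fin s
    x-top   : ∀ a → layer (x a) ≤ layer (y p)
    y-top   : ∀ a → layer (y a) ≤ layer (y p)

module Assembly {G : Graph} {F : Rel (Fin (n G)) 0ℓ} (F? : Decidable F)
  (F⊆E : ∀ {u v} → F u v → E G u v) (F-sym : Symmetric F)
  (L : Layering F) (P : LayerPairs L s) where

  open Layering L
  open LayerPairs P

  V : Set
  V = Fin (n G)

  top : ℕ
  top = layer (y p)

  -- When `x p` and `y p` share the top layer, `side` separates them and would cut their edge;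
  -- moving `y p` to the side of `x p` keeps it. Towards lower layers, saturation offers `y p`
  -- neighbours on whichever side is wanted.
  S : V → Bool
  S v = if does (v ≟ y p) then side (x p) else side v

  x≢y : ∀ {a b} → x a ≢ y b
  x≢y {a} {b} e = irrefl G (F⊆E (subst (λ v → F v (y b)) e (xy a b)))

  S-top : S (y p) ≡ side (x p)
  S-top = if-yes (y p ≟ y p) refl

  S-old : ∀ {v} → v ≢ y p → S v ≡ side v
  S-old {v} v≢y = if-no (v ≟ y p) v≢y

  -- Branch set a consists of the layers of x a and y a. As y p lies in the
  -- topmost layer, the p-th one splits off y p alone, which yields the extra
  -- branch set; if x p is in that layer too, it is all that is kept of it.
  Branch : Fin (suc s) → V → Set
  Branch zero    v = v ≡ y p
  Branch (suc a) v = v ≢ y p × (layer v ≡ layer (x a) ⊎ layer v ≡ layer (y a)) × (layer v ≡ top → v ≡ x p)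

  branch? : ∀ a v → Dec (Branch a v)
  branch? zero    v = v ≟ y p
  branch? (suc a) v = ¬? (v ≟ y p) ×-dec (layer v ℕ.≟ layer (x a) ⊎-dec layer v ℕ.≟ layer (y a))
                      ×-dec (layer v ℕ.≟ top →-dec v ≟ x p)

  disjoint : ∀ {a b v} → Branch a v → Branch b v → a ≡ b
  disjoint {zero}  {zero}  _ _ = refl
  disjoint {zero}  {suc _} e (q , _) = contradiction e q
  disjoint {suc _} {zero}  (q , _) e = contradiction e q
  disjoint {suc a} {suc b} (_ , i , _) (_ , j , _) = cong suc (go i j)
    where
    go : ∀ {l} → l ≡ layer (x a) ⊎ l ≡ layer (y a) → l ≡ layer (x b) ⊎ l ≡ layer (y b) → a ≡ b
    go (inj₁ e) (inj₁ f) = x-inj (≡.trans (≡.sym e) f)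
    go (inj₁ e) (inj₂ f) = aligned (≡.trans (≡.sym e) f)
    go (inj₂ e) (inj₁ f) = ≡.sym (aligned (≡.trans (≡.sym f) e))
    go (inj₂ e) (inj₂ f) = y-inj (≡.trans (≡.sym e) f)

  below-top : ∀ {a v} → layer v ≢ top → layer v ≡ layer (x a) ⊎ layer v ≡ layer (y a) → Branch (suc a) v
  below-top q i = (λ { refl → q refl }) , i , λ e → contradiction e q

  x∈Branch : ∀ a → Branch (suc a) (x a)
  x∈Branch a = x≢y , inj₁ refl , λ e → cong x (aligned e)

  root : ∀ a → ∃ (Branch a)
  root zero    = y p , refl
  root (suc a) = x a , x∈Branch a

  -- Two adjacent layers are joined both by edges whose ends lie on equal
  -- sides (d = false) and by edges whose ends lie on opposite sides (d = true).
  link : ∀ d {u v} → F u v → layer u ≢ layer v →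
         ∃₂ λ u′ v′ → layer u′ ≡ layer u × layer v′ ≡ layer v × F u′ v′ × side u′ ≡ d xor side v′
  link d {u} {v} f q with ℕ.<-cmp (layer u) (layer v)
  ... | tri< l _ _ = let (w , e , s , g) = saturated l (F-sym f) (d xor side v) in
                     w , v , e , refl , F-sym g , s
  ... | tri≈ _ e _ = contradiction e q
  ... | tri> _ _ l = let (w , e , s , g) = saturated l f (d xor side u) in
                     u , w , refl , e , g , ≡.trans (xor-involutive d (side u)) (cong (d xor_) (≡.sym s))

  _─[_]─_ : V → Fin (suc s) → V → Set
  u ─[ a ]─ v = BranchEdge {G = G} F? F⊆E F-sym S Branch a u v

  within : ∀ {a u v} → layer u ≢ top → layer u ≡ layer (x a) ⊎ layer u ≡ layer (y a) → layer u ≡ layer v →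
           Star (λ u v → u ─[ suc a ]─ v) u v
  within {a} {u} q i e = Star.map edge (connected e)
    where
    edge : ∀ {v w} → LayerEdge F layer side (layer u) v w → v ─[ suc a ]─ w
    edge {v} {w} (lv , lw , f , s) = bv , bw , f , subst₂ _≢_ (≡.sym (S-old (proj₁ bv))) (≡.sym (S-old (proj₁ bw))) s
      where
      place : ∀ {t} → layer t ≡ layer u → Branch (suc a) t
      place e = below-top (subst (_≢ top) (≡.sym e) q) (subst (λ l → l ≡ layer (x a) ⊎ l ≡ layer (y a)) (≡.sym e) i)
      bv = place lv
      bw = place lw

  -- Layers are connected by themselves. When `x a` and `y a` lie in different ones, `link true`
  -- supplies an edge between opposite sides, hence in the cut, through which the layer of `y a`
  -- reaches that of `x a`.
  to-root : ∀ a {v} → Branch a v → Star (λ u v → u ─[ a ]─ v) v (proj₁ (root a))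
  to-root zero    refl = ε
  to-root (suc a) {v} (v≢y , i , h) with layer v ℕ.≟ top
  -- Of the top layer a branch set keeps only `x p`; then `a` is `p`, and `v` is the root already.
  ... | yes e with h e | i
  ...   | refl | inj₁ f with x-inj f
  ...     | refl = ε
  to-root (suc a) {v} (v≢y , i , h) | yes e | refl | inj₂ f with y-inj (≡.trans (≡.sym f) e)
  ...     | refl = ε
  to-root (suc a) {v} (v≢y , inj₁ e , h) | no q = within q (inj₁ e) e
  to-root (suc a) {v} (v≢y , inj₂ e , h) | no q with layer (x a) ℕ.≟ layer (y a)
  ... | yes f = within q (inj₂ e) (≡.trans e (≡.sym f))
  ... | no x≢y with link true (xy a a) x≢y
  ...   | u′ , v′ , lu , lv , f , s =
    within q (inj₂ e) (≡.trans e (≡.sym lv)) ◅◅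
    (bv , bu , F-sym f , crossing) ◅
    within u≢ (inj₁ lu) lu
    where
    x≢top : layer (x a) ≢ top
    x≢top r = q (≡.trans e (cong (layer ∘ y) (aligned r)))
    u≢ : layer u′ ≢ top
    u≢ = subst (_≢ top) (≡.sym lu) x≢top
    bu : Branch (suc a) u′
    bu = below-top u≢ (inj₁ lu)
    bv : Branch (suc a) v′
    bv = below-top (subst (_≢ top) (≡.trans e (≡.sym lv)) q) (inj₂ lv)
    crossing : S v′ ≢ S u′
    crossing r = not-¬ {side v′} refl (≡.trans (≡.sym (S-old (proj₁ bv))) (≡.trans r (≡.trans (S-old (proj₁ bu)) s)))

  Touching : Fin (suc s) → Fin (suc s) → Set
  Touching a b = ∃₂ λ u v → Branch a u × Branch b v × F u v × S u ≡ S v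

  touching-sym : ∀ {a b} → Touching a b → Touching b a
  touching-sym (u , v , bu , bv , f , s) = v , u , bv , bu , F-sym f , ≡.sym s

  -- If the layer of `x a` is below the top, `y p` sees both its sides, and a neighbour agreeing
  -- with `S (y p)` can be chosen. Otherwise `a` is `p`, and the choice of `S` left the edge to
  -- `x p` uncut.
  touching-top : ∀ a → Touching zero (suc a)
  touching-top a with layer (x a) ℕ.≟ top
  ... | yes e with aligned e
  ...   | refl = y p , x p , refl , x∈Branch p , F-sym (xy p p) , ≡.trans S-top (≡.sym (S-old x≢y))
  touching-top a | no q with saturated (ℕ.≤∧≢⇒< (x-top a) q) (F-sym (xy a p)) (side (x p))
  ... | w , e , s , f = y p , w , refl , bw , f , ≡.trans S-top (≡.trans (≡.sym s) (≡.sym (S-old (proj₁ bw))))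
    where
    bw : Branch (suc a) w
    bw = below-top (subst (_≢ top) (≡.sym e) q) (inj₁ e)

  -- `b ≢ p` keeps the layer of `y b` off the top, so all of it is in the branch set. `link false`
  -- then gives an uncut edge, unless `x a` is in the top layer: there `x a` is kept as one end and
  -- saturation chooses only the other.
  touching-≢p : ∀ {a b} → a ≢ b → b ≢ p → Touching (suc a) (suc b)
  touching-≢p {a} {b} a≢b b≢p with layer (x a) ℕ.≟ top
  ... | yes e with saturated (subst (layer (y b) <_) (≡.sym e) (ℕ.≤∧≢⇒< (y-top b) (b≢p ∘ y-inj))) (xy a b) (side (x a))
  ...   | w , lw , s , f = x a , w , x∈Branch a , bw , f ,
          ≡.trans (S-old x≢y) (≡.trans (≡.sym s) (≡.sym (S-old (proj₁ bw))))
    where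
    bw : Branch (suc b) w
    bw = below-top (λ r → b≢p (y-inj (≡.trans (≡.sym lw) r))) (inj₂ lw)
  touching-≢p {a} {b} a≢b b≢p | no q with link false (xy a b) (a≢b ∘ aligned)
  ... | u , v , lu , lv , f , s = u , v , bu , bv , f , ≡.trans (S-old (proj₁ bu)) (≡.trans s (≡.sym (S-old (proj₁ bv))))
    where
    bu : Branch (suc a) u
    bu = below-top (subst (_≢ top) (≡.sym lu) q) (inj₁ lu)
    bv : Branch (suc b) v
    bv = below-top (λ r → b≢p (y-inj (≡.trans (≡.sym lv) r))) (inj₂ lv)

  touching : ∀ a b → a ≢ b → Touching a b
  touching zero    zero    q = contradiction refl q
  touching zero    (suc b) _ = touching-top b
  touching (suc a) zero    _ = touching-sym (touching-top a)
  touching (suc a) (suc b) q with b ≟ p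
  ... | no b≢p   = touching-≢p (q ∘ cong suc) b≢p
  ... | yes refl = touching-sym (touching-≢p (q ∘ cong suc ∘ ≡.sym) (q ∘ cong suc))

  oddMinor : OddMinor G (suc s)
  oddMinor = branchSets⇒oddMinor F? F⊆E F-sym S Branch branch? disjoint root to-root touching

-- Zigzags and the decidable subgraph of known edges

record Alternating (F : Rel (Fin k) 0ℓ) {c} (f : Fin k → Fin c) (s : ℕ) : Set where
  field
    x y : Fin s → Fin k
    xy  : ∀ a b → F (x a) (y b)
    x<y : ∀ {a b} → toℕ a ≤ toℕ b → toℕ (f (x a)) < toℕ (f (y b))
    y<x : ∀ {a b} → toℕ a < toℕ b → toℕ (f (y a)) < toℕ (f (x b))

-- Ties are broken by the vertex itself, which makes the colouring injective and so proper for all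
-- of `G`, even if `f` respects only some of the edges. `combine` orders lexicographically, so
-- strict inequalities of `f` persist.
refine : ∀ {c} → (Fin k → Fin c) → Fin k → Fin (c * k)
refine f u = combine (f u) u

module KnownEdges (G : Graph) (t : ℕ) (zig : ZigAtLeast G t) (c : ℕ) where

  open Zigzag

  refine-proper : (f : Fin (n G) → Fin c) → Proper G (toℕ ∘ refine f)
  refine-proper f u v e q =
    irrefl G (subst (E G u) (≡.sym (combine-injectiveʳ (f u) u (f v) v (toℕ-injective q))) e)

  module _ (f : Fin (n G) → Fin c) where
    zigzag = zig (toℕ ∘ refine f) (refine-proper f)

    size : ℕ
    size = proj₁ zigzag

    long : t ≤ size
    long = proj₁ (proj₂ zigzag)

    path : Zigzag G (toℕ ∘ refine f) size
    path = proj₂ (proj₂ zigzag)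

  Arc : Rel (Fin (n G)) 0ℓ
  Arc u v = ∃ λ (e : Fin (c ^ n G)) → let Z = path (finToFun e) in
            ∃₂ λ i j → toℕ i % 2 ≡ 0 × toℕ j % 2 ≡ 1 × z Z i ≡ u × z Z j ≡ v

  Known : Rel (Fin (n G)) 0ℓ
  Known u v = Arc u v ⊎ Arc v u

  arc? : Decidable Arc
  arc? u v = any? λ e → any? λ i → any? λ j →
    toℕ i % 2 ℕ.≟ 0 ×-dec toℕ j % 2 ℕ.≟ 1 ×-dec z (path (finToFun e)) i ≟ u ×-dec z (path (finToFun e)) j ≟ v

  known? : Decidable Known
  known? u v = arc? u v ⊎-dec arc? v u

  known⇒edge : ∀ {u v} → Known u v → E G u v
  known⇒edge (inj₁ (e , i , j , p , q , refl , refl)) = complete (path (finToFun e)) i j p q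
  known⇒edge (inj₂ (e , i , j , p , q , refl , refl)) = Graph.sym G (complete (path (finToFun e)) i j p q)

  known-sym : Symmetric Known
  known-sym (inj₁ a) = inj₂ a
  known-sym (inj₂ a) = inj₁ a

  -- `Known` is built before `f` is given, yet contains the edges of a zigzag for the refinement of
  -- `f`, as all colourings with `c` colours were consulted. Hence properness on `Known` alone makes
  -- the colours alternate strictly.
  alternating : (f : Fin (n G) → Fin c) → (∀ {u v} → Known u v → f u ≢ f v) →
                s * 2 ≤ t → Alternating Known f s
  alternating {s} f proper s*2≤t = record
    { x   = z Z ∘ even
    ; y   = z Z ∘ odd
    ; xy  = known
    ; x<y = λ {a} {b} a≤b → rise (inj₁ (known a b))
              (subst₂ _<_ (≡.sym (toℕ-even a)) (≡.sym (toℕ-odd b)) (s≤s (ℕ.*-monoˡ-≤ 2 a≤b)))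
    ; y<x = λ {a} {b} a<b → rise (inj₂ (known b a))
              (subst₂ _<_ (≡.sym (toℕ-odd a)) (≡.sym (toℕ-even b)) (ℕ.*-monoˡ-≤ 2 a<b))
    }
    where
    e = funToFin f
    Z = path (finToFun e)
    len = size (finToFun e)

    odd< : (a : Fin s) → suc (toℕ a * 2) < len
    odd< a = ℕ.≤-trans (ℕ.*-monoˡ-≤ 2 (toℕ<n a)) (ℕ.≤-trans s*2≤t (long (finToFun e)))

    even odd : Fin s → Fin len
    even a = fromℕ< (ℕ.<-trans (ℕ.n<1+n _) (odd< a))
    odd a  = fromℕ< (odd< a)

    toℕ-even : ∀ a → toℕ (even a) ≡ toℕ a * 2
    toℕ-even a = toℕ-fromℕ< _

    toℕ-odd : ∀ a → toℕ (odd a) ≡ suc (toℕ a * 2)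
    toℕ-odd a = toℕ-fromℕ< _

    known : ∀ a b → Known (z Z (even a)) (z Z (odd b))
    known a b = inj₁ (e , even a , odd b ,
      ≡.trans (cong (_% 2) (toℕ-even a)) (m*n%n≡0 (toℕ a) 2) ,
      ≡.trans (cong (_% 2) (toℕ-odd b)) ([m+kn]%n≡m%n 1 (toℕ b) 2) , refl , refl)

    rise : ∀ {i j} → Known (z Z i) (z Z j) ⊎ Known (z Z j) (z Z i) → toℕ i < toℕ j →
           toℕ (f (z Z i)) < toℕ (f (z Z j))
    -- The two vertices form a known edge, so `f` differs on them; a drop in `f` would be a drop in
    -- the refined colour, against `increasing`.
    rise {i} {j} k i<j = ℕ.≰⇒> λ fj≤fi →
      ℕ.<-asym (increasing Z i j i<j)
        (combine-monoˡ-< _ _ (subst₂ _<_ (≡.sym (lift (z Z j))) (≡.sym (lift (z Z i))) (ℕ.≤∧≢⇒< fj≤fi (differ k ∘ toℕ-injective))))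
      where
      lift : ∀ v → toℕ (finToFun e v) ≡ toℕ (f v)
      lift v = cong toℕ (finToFun-funToFin f v)

      differ : Known (z Z i) (z Z j) ⊎ Known (z Z j) (z Z i) → f (z Z j) ≢ f (z Z i)
      differ (inj₁ k) = proper k ∘ ≡.sym
      differ (inj₂ k) = proper k

-- Colouring by layers and the conclusion

module LayerColouring {F : Rel (Fin k) 0ℓ} (L : Layering F) where

  open Layering L

  bit : Bool → Fin 2
  bit false = zero
  bit true  = suc zero

  bit-injective : ∀ {a b} → bit a ≡ bit b → a ≡ b
  bit-injective {false} {false} _ = refl
  bit-injective {true}  {true}  _ = refl

  level : Fin k → Fin k
  level v = fromℕ< (layer< v)

  level-≡ : ∀ {u v} → layer u ≡ layer v → level u ≡ level v
  level-≡ {u} {v} e = toℕ-injective (≡.trans (toℕ-fromℕ< (layer< u)) (≡.trans e (≡.sym (toℕ-fromℕ< (layer< v)))))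

  colour : Fin k → Fin (k * 2)
  colour v = combine (level v) (bit (side v))

  colour-proper : ∀ {u v} → F u v → colour u ≢ colour v
  colour-proper {u} {v} f e = bipartite
    (≡.trans (≡.sym (toℕ-fromℕ< (layer< u)))
      (≡.trans (cong toℕ (combine-injectiveˡ (level u) (bit (side u)) (level v) (bit (side v)) e)) (toℕ-fromℕ< (layer< v)))) f
    (bit-injective (combine-injectiveʳ (level u) (bit (side u)) (level v) (bit (side v)) e))

  <⇒layer≤ : ∀ {u v} → toℕ (colour u) < toℕ (colour v) → layer u ≤ layer v
  <⇒layer≤ {u} {v} u<v = ℕ.≮⇒≥ λ v<u → ℕ.<-asym u<v
    (combine-monoˡ-< _ _ (subst₂ _<_ (≡.sym (toℕ-fromℕ< (layer< v))) (≡.sym (toℕ-fromℕ< (layer< u))) v<u))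

  -- A layer has only two sides, so three colours cannot alternate within it.
  <<⇒layer< : ∀ {u v w} → F u v → F v w → toℕ (colour u) < toℕ (colour v) →
              toℕ (colour v) < toℕ (colour w) → layer u < layer w
  <<⇒layer< {u} {v} {w} uv vw u<v v<w = ℕ.≤∧≢⇒< (ℕ.≤-trans u≤v v≤w) λ u≡w →
    let v≡u = ℕ.≤-antisym (ℕ.≤-trans v≤w (ℕ.≤-reflexive (≡.sym u≡w))) u≤v
        su≡sw = ≡.trans (¬-not (bipartite (≡.sym v≡u) uv))
                        (≡.sym (¬-not (≢-sym (bipartite (≡.trans v≡u u≡w) vw))))
    in ℕ.<⇒≢ (ℕ.<-trans u<v v<w) (cong toℕ (cong₂ combine (level-≡ u≡w) (cong bit su≡sw)))
    where
    u≤v = <⇒layer≤ u<v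
    v≤w = <⇒layer≤ v<w

-- For `a < b` the colours of `x a`, `y a`, `x b` increase, so the layers of the `x` strictly
-- increase, and likewise those of the `y`; both are then injective and can be matched. Only the `x`
-- are permuted, so the last `y`, of largest colour, still marks the top layer.
alternating⇒oddMinor : {G : Graph} {F : Rel (Fin (n G)) 0ℓ} (F? : Decidable F)
  (F⊆E : ∀ {u v} → F u v → E G u v) (F-sym : Symmetric F) (L : Layering F) →
  Alternating F (LayerColouring.colour L) (suc s) → OddMinor G (suc (suc s))
alternating⇒oddMinor {s = s} F? F⊆E F-sym L A =
  Assembly.oddMinor F? F⊆E F-sym L (record
    { x       = x ∘ π
    ; y       = y
    ; xy      = λ a b → xy (π a) b
    ; x-inj   = Injection.injective (↔⇒↣ (proj₁ matching)) ∘ x-inj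
    ; y-inj   = y-inj
    ; aligned = proj₂ matching
    ; p       = last
    ; x-top   = λ a → <⇒layer≤ (x<y (≤last (π a)))
    ; y-top   = y-top
    })
  where
  open Layering L
  open LayerColouring L
  open Alternating A

  x-mono : ∀ {a b} → toℕ a < toℕ b → layer (x a) < layer (x b)
  x-mono {a} {b} a<b = <<⇒layer< (xy a a) (F-sym (xy b a)) (x<y {a} {a} ℕ.≤-refl) (y<x a<b)

  y-mono : ∀ {a b} → toℕ a < toℕ b → layer (y a) < layer (y b)
  y-mono {a} {b} a<b = <<⇒layer< (F-sym (xy b a)) (xy b b) (y<x a<b) (x<y {b} {b} ℕ.≤-refl)

  mono⇒injective : (f : Fin (suc s) → ℕ) → (∀ {a b} → toℕ a < toℕ b → f a < f b) → ∀ {a b} → f a ≡ f b → a ≡ b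
  mono⇒injective f mono {a} {b} e with ℕ.<-cmp (toℕ a) (toℕ b)
  ... | tri< l _ _ = contradiction e (ℕ.<⇒≢ (mono l))
  ... | tri≈ _ q _ = toℕ-injective q
  ... | tri> _ _ l = contradiction (≡.sym e) (ℕ.<⇒≢ (mono l))

  x-inj : ∀ {a b} → layer (x a) ≡ layer (x b) → a ≡ b
  x-inj = mono⇒injective (layer ∘ x) x-mono

  y-inj : ∀ {a b} → layer (y a) ≡ layer (y b) → a ≡ b
  y-inj = mono⇒injective (layer ∘ y) y-mono

  matching = align (layer ∘ x) (layer ∘ y) x-inj y-inj

  π : Fin (suc s) → Fin (suc s)
  π a = proj₁ matching ⟨$⟩ʳ a

  last : Fin (suc s)
  last = fromℕ s

  ≤last : ∀ a → toℕ a ≤ toℕ last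
  ≤last a = subst (toℕ a ≤_) (≡.sym (toℕ-fromℕ s)) (s≤s⁻¹ (toℕ<n a))

  y-top : ∀ a → layer (y a) ≤ layer (y last)
  y-top a with toℕ a ℕ.≟ toℕ last
  ... | yes e = ℕ.≤-reflexive (cong (layer ∘ y) (toℕ-injective e))
  ... | no q  = ℕ.<⇒≤ (y-mono (ℕ.≤∧≢⇒< (≤last a) q))

zig⇒oddMinor : (G : Graph) (s t : ℕ) → s * 2 ≤ t → 1 ≤ t → ZigAtLeast G t → OddMinor G (suc s)
-- For the one-vertex graph the first vertex of a nonempty zigzag suffices; there is no pair to
-- serve as `p`.
zig⇒oddMinor G zero t _ 1≤t zig with zig toℕ (λ u v e q → irrefl G (subst (E G u) (≡.sym (toℕ-injective q)) e))
... | zero , t≤0 , _ = contradiction (ℕ.≤-trans 1≤t t≤0) λ ()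
... | suc _ , _ , Z = branchSets⇒oddMinor {F = λ _ _ → ⊥} (λ _ _ → no λ ()) (λ ()) (λ ()) (λ _ → false)
  (λ _ v → v ≡ Zigzag.z Z zero) (λ _ v → v ≟ _) (λ { {zero} {zero} _ _ → refl }) (λ _ → _ , refl)
  (λ { _ refl → ε }) (λ { zero zero q → contradiction refl q })
zig⇒oddMinor G (suc s) t 2s≤t _ zig =
  alternating⇒oddMinor known? known⇒edge known-sym L (alternating colour colour-proper 2s≤t)
  where
  -- Two colours for each of at most `n G` layers: the palette is fixed before the layering, which
  -- is itself built on `Known`.
  open KnownEdges G t zig (n G * 2)

  L : Layering Known
  L = GreedyLayering.layering known? known-sym (irrefl G ∘ known⇒edge)

  open LayerColouring L

theorem1 : (t : ℕ) → 1 ≤ t → (G : Graph) → ZigAtLeast G t → OddMinor G (t / 2 + 1)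
theorem1 t 1≤t G zig =
  subst (OddMinor G) (ℕ.+-comm 1 (t / 2)) (zig⇒oddMinor G (t / 2) t (m/n*n≤m t 2) 1≤t zig)
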